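{- There exists an absolute constant $C$ such that the following holds. Let $H$ be an $n$-vertex graph of maximum degree $\Delta\ge 2$ and chromatic number $\chi=\chi(H)\ge 3$. Then $ER(H)\le n^{C\Delta\chi n}$.
   Context: Edge-colorings of $K_N$ may use arbitrarily many colors. A copy of $H$ in $K_N$ (injective $\varphi:V(H)\to V(K_N)$) is canonically colored if it is monochromatic (all edges same color), rainbow (all edges distinct colors), or lexicographic: there is an ordering $v_1,\dots,v_n$ of $V(H)$ such that for each $i$ all edges $\varphi(v_i)\varphi(v_j)$ with $v_iv_j\in E(H)$, $j>i$, have the same color $c_i$, and these colors are distinct for different $v_i$. $ER(H)$ is the least $N$ such that every edge-coloring of $K_N$ contains a canonically colored copy of $H$. -}

module Defs where

open import Data.Nat using (ℕ; zero; suc; _+_; _*_; _^_; _≤_; _<_)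
open import Data.Fin using (Fin)
open import Data.Bool using (Bool; true; false; if_then_else_)
open import Data.Product using (Σ; ∃; ∃-syntax; _×_; _,_)
open import Data.Sum using (_⊎_)
open import Relation.Binary.PropositionalEquality using (_≡_)
open import Relation.Nullary using (¬_)
open import Function.Definitions using (Injective)

record Graph (n : ℕ) : Set where
  field
    adj   : Fin n → Fin n → Bool
    sym   : ∀ u v → adj u v ≡ adj v u
    irrefl : ∀ u → adj u u ≡ false

open Graph public

Adj : ∀ {n} → Graph n → Fin n → Fin n → Set
Adj H u v = adj H u v ≡ true

sumFin : ∀ n → (Fin n → ℕ) → ℕ
sumFin zero    f = 0
sumFin (suc n) f = f Fin.zero + sumFin n (λ i → f (Fin.suc i))

degree : ∀ {n} → Graph n → Fin n → ℕ
degree {n} H v = sumFin n (λ w → if adj H v w then 1 else 0)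

IsMaxDegree : ∀ {n} → Graph n → ℕ → Set
IsMaxDegree {n} H Δ = (∀ v → degree H v ≤ Δ) × (∃[ v ] degree H v ≡ Δ)

ProperColoring : ∀ {n} → Graph n → (k : ℕ) → (Fin n → Fin k) → Set
ProperColoring H k f = ∀ u v → Adj H u v → ¬ (f u ≡ f v)

Colorable : ∀ {n} → Graph n → ℕ → Set
Colorable {n} H k = Σ (Fin n → Fin k) (ProperColoring H k)

IsChromaticNumber : ∀ {n} → Graph n → ℕ → Set
IsChromaticNumber H χ = Colorable H χ × (∀ k → k < χ → ¬ Colorable H k)

-- Edge-colourings of K_N with arbitrarily many colours (colours in ℕ);
-- only values on distinct pairs matter; required symmetric.
EdgeColoring : ℕ → Set
EdgeColoring N = Σ (Fin N → Fin N → ℕ) (λ c → ∀ x y → c x y ≡ c y x)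

module _ {n N : ℕ} (H : Graph n) (col : EdgeColoring N) (φ : Fin n → Fin N) where
  private
    c : Fin N → Fin N → ℕ
    c = Σ.proj₁ col

  Monochromatic : Set
  Monochromatic = ∃[ a ] (∀ u v → Adj H u v → c (φ u) (φ v) ≡ a)

  Rainbow : Set
  Rainbow = ∀ u v u' v' → Adj H u v → Adj H u' v' →
            c (φ u) (φ v) ≡ c (φ u') (φ v') →
            (u ≡ u' × v ≡ v') ⊎ (u ≡ v' × v ≡ u')

  Lexicographic : Set
  Lexicographic = Σ (Fin n → Fin n) λ ord → Injective _≡_ _≡_ ord ×
                  Σ (Fin n → ℕ) λ a → Injective _≡_ _≡_ a ×
                  (∀ u v → Adj H u v → Data.Fin._<_ (ord u) (ord v) →
                     c (φ u) (φ v) ≡ a u)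

  CanonicalCopy : Set
  CanonicalCopy = Injective _≡_ _≡_ φ ×
                  (Monochromatic ⊎ Rainbow ⊎ Lexicographic)

ERProperty : ∀ {n} → Graph n → ℕ → Set
ERProperty {n} H N = ∀ (col : EdgeColoring N) →
  ∃[ φ ] CanonicalCopy H col φ

-- ER(H) ≤ M  (the least N with the property is ≤ M)
ER≤ : ∀ {n} → Graph n → ℕ → Set
ER≤ H M = ∃[ N ] (N ≤ M × ERProperty H N)

{-# OPTIONS --safe #-}
-- Keep a vertex set S and a list U of fewer than n used colours, and shrink S by a factor n^O(Δ) at a time.
-- If some v ∈ S has at least |S|/q neighbours in S in a colour a ∉ U, pass to these neighbours and add a to U.
-- Otherwise, if some a ∈ U is such that at least |S|/q vertices have colour-a degree at least |S|/q, dependent random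
-- choice gives a large S' ⊆ S in which any Δ vertices have more than n common colour-a neighbours in S.
-- If neither is possible, after deleting the few vertices of large degree in a colour of U, every colour has degree
-- below |S|/q at every remaining vertex, and a rainbow K_n is found greedily.
-- After n (χ + 1) steps, either n steps of the first kind form a lexicographic K_n, or one colour was used in χ steps
-- of the second kind, and then H is embedded monochromatically, one colour class per step, from the innermost set outwards.
module Submission where

open import Defs hiding (sym)
open import Data.Bool using (true; false; if_then_else_)
open import Data.Bool.Properties using () renaming (_≟_ to _≟ᵇ_)
open import Data.Fin using (Fin; toℕ; inject≤)
import Data.Fin as Fin
open import Data.Fin.Properties using (toℕ-inject≤; toℕ<n; toℕ-injective) renaming (<-cmp to Fin-<-cmp)
open import Data.List
  using (List; []; _∷_; length; map; filter; cartesianProductWith; _++_; replicate; lookup; allFin; tabulate)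
open import Data.List.Membership.Propositional using (_∈_; _∉_; find; lose)
open import Data.List.Membership.Propositional.Properties
  using (∈-cartesianProductWith⁺; ∈-filter⁺; ∈-filter⁻; ∈-map⁺; ∈-allFin; ∈-lookup)
open import Data.List.Properties
  using (map-++; map-∘; length-map; length-filter; length-++; length-replicate; length-tabulate)
open import Data.List.Relation.Binary.Subset.Propositional using (_⊆_)
open import Data.List.Relation.Unary.All as All using (All; []; _∷_; all?)
open import Data.List.Relation.Unary.All.Properties using (All-swap; map⁺; ++⁺; ++⁻ˡ; replicate⁺)
open import Data.List.Relation.Unary.AllPairs using (AllPairs; []; _∷_)
open import Data.List.Relation.Unary.Any using (Any; here; there; any?)
open import Data.List.Relation.Unary.Unique.Propositional using (Unique)
open import Data.List.Relation.Unary.Unique.Propositional.Properties using (filter⁺; allFin⁺)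
open import Data.Nat
  using (ℕ; zero; suc; _+_; _*_; _^_; _∸_; _≤_; _<_; z≤n; s≤s; _<?_; _≤?_; _≟_; NonZero;
         ≢-nonZero; >-nonZero; >-nonZero⁻¹)
open import Data.Nat.ListAction using (sum)
open import Data.Nat.ListAction.Properties using (sum-++)
open import Data.Nat.Properties hiding (_≟_; _≤?_; _<?_)
open import Data.Nat.Tactic.RingSolver using (solve-∀)
open import Data.Product using (∃-syntax; _×_; _,_; proj₁; proj₂)
open import Data.Sum using (_⊎_; inj₁; inj₂; map₂)
open import Data.Unit using (tt)
open import Data.Vec.Functional using (updateAt)
open import Data.Vec.Functional.Properties using (updateAt-updates; updateAt-minimal)
open import Function using (_∘_; id; const)
open import Level using (0ℓ)
open import Relation.Binary using (DecidableEquality; tri<; tri≈; tri>)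
open import Relation.Binary.PropositionalEquality
  using (_≡_; _≢_; refl; sym; trans; cong; cong₂; subst; module ≡-Reasoning)
open import Relation.Nullary using (Dec; does; yes; no; ¬_; ¬?; contradiction; _×-dec_; _⊎-dec_)
open import Relation.Unary using (Pred; Decidable)

private variable
  A B C : Set

-- Finite sums over lists.

∑ : List A → (A → ℕ) → ℕ
∑ xs f = sum (map f xs)

∑-cong : ∀ {f g : A → ℕ} (xs : List A) → (∀ x → f x ≡ g x) → ∑ xs f ≡ ∑ xs g
∑-cong []       e = refl
∑-cong (x ∷ xs) e = cong₂ _+_ (e x) (∑-cong xs e)

∑-mono : ∀ {f g : A → ℕ} (xs : List A) → (∀ {x} → x ∈ xs → f x ≤ g x) → ∑ xs f ≤ ∑ xs g
∑-mono []       e = z≤n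
∑-mono (x ∷ xs) e = +-mono-≤ (e (here refl)) (∑-mono xs (e ∘ there))

∑-+ : ∀ (f g : A → ℕ) xs → ∑ xs (λ x → f x + g x) ≡ ∑ xs f + ∑ xs g
∑-+ f g []       = refl
∑-+ f g (x ∷ xs) = trans (cong (f x + g x +_) (∑-+ f g xs)) (interchange (f x) (g x) _ _)
  where
  interchange : ∀ a b c d → a + b + (c + d) ≡ a + c + (b + d)
  interchange = solve-∀

∑-*ˡ : ∀ k (f : A → ℕ) xs → ∑ xs (λ x → k * f x) ≡ k * ∑ xs f
∑-*ˡ k f []       = sym (*-zeroʳ k)
∑-*ˡ k f (x ∷ xs) = trans (cong (k * f x +_) (∑-*ˡ k f xs)) (sym (*-distribˡ-+ k (f x) _))

∑-const : ∀ k (xs : List A) → ∑ xs (λ _ → k) ≡ length xs * k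
∑-const k []       = refl
∑-const k (x ∷ xs) = cong (k +_) (∑-const k xs)

∑-bound : ∀ {f : A → ℕ} {k} (xs : List A) → (∀ {x} → x ∈ xs → f x ≤ k) → ∑ xs f ≤ length xs * k
∑-bound {k = k} xs h = ≤-trans (∑-mono xs h) (≤-reflexive (∑-const k xs))

∑-swap : ∀ (f : A → B → ℕ) xs ys → ∑ xs (λ x → ∑ ys (f x)) ≡ ∑ ys (λ y → ∑ xs (λ x → f x y))
∑-swap f []       ys = sym (trans (∑-const 0 ys) (*-zeroʳ (length ys)))
∑-swap f (x ∷ xs) ys = trans (cong (∑ ys (f x) +_) (∑-swap f xs ys)) (sym (∑-+ (f x) _ ys))

∑-cartesian : ∀ (h : A → B → C) (g : C → ℕ) xs ys →
  ∑ (cartesianProductWith h xs ys) g ≡ ∑ xs (λ x → ∑ ys (λ y → g (h x y)))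
∑-cartesian h g []       ys = refl
∑-cartesian h g (x ∷ xs) ys = begin
  sum (map g (map (h x) ys ++ cartesianProductWith h xs ys))
    ≡⟨ cong sum (map-++ g (map (h x) ys) _) ⟩
  sum (map g (map (h x) ys) ++ map g (cartesianProductWith h xs ys))
    ≡⟨ sum-++ (map g (map (h x) ys)) _ ⟩
  sum (map g (map (h x) ys)) + ∑ (cartesianProductWith h xs ys) g
    ≡⟨ cong₂ _+_ (cong sum (sym (map-∘ ys))) (∑-cartesian h g xs ys) ⟩
  ∑ ys (λ y → g (h x y)) + ∑ xs (λ x → ∑ ys (λ y → g (h x y))) ∎
  where open ≡-Reasoning

-- The first-moment method: if `f` exceeds `g` at the head, the comparison of sums survives for the
-- tail, so the search cannot fail.
∑-averaging : ∀ (f g : A → ℕ) xs → 0 < length xs → ∑ xs f ≤ ∑ xs g → ∃[ x ] f x ≤ g x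
∑-averaging f g (x ∷ xs) _ = go x xs
  where
  go : ∀ x xs → ∑ (x ∷ xs) f ≤ ∑ (x ∷ xs) g → ∃[ x ] f x ≤ g x
  go x xs       h with f x ≤? g x
  go x xs       h | yes p = x , p
  go x []       h | no ¬p = contradiction (+-cancelʳ-≤ 0 (f x) (g x) h) ¬p
  go x (y ∷ ys) h | no ¬p = go y ys (≮⇒≥ λ lt → <⇒≱ (+-mono-< (≰⇒> ¬p) lt) h)

-- Indicators, counting and union bounds.

⟦_⟧ : {P : Set} → Dec P → ℕ
⟦ d ⟧ = if does d then 1 else 0

⟦⟧-mono : {P Q : Set} (p : Dec P) (q : Dec Q) → (P → Q) → ⟦ p ⟧ ≤ ⟦ q ⟧
⟦⟧-mono (yes p) (yes q) f = ≤-refl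
⟦⟧-mono (yes p) (no ¬q) f = contradiction (f p) ¬q
⟦⟧-mono (no ¬p) q       f = z≤n

⟦⟧-cong : {P Q : Set} (p : Dec P) (q : Dec Q) → (P → Q) → (Q → P) → ⟦ p ⟧ ≡ ⟦ q ⟧
⟦⟧-cong p q f g = ≤-antisym (⟦⟧-mono p q f) (⟦⟧-mono q p g)

⟦⟧-yes : {P : Set} (p : Dec P) → P → ⟦ p ⟧ ≡ 1
⟦⟧-yes (yes _) _ = refl
⟦⟧-yes (no ¬p) p = contradiction p ¬p

⟦⟧-no : {P : Set} (p : Dec P) → ¬ P → ⟦ p ⟧ ≡ 0
⟦⟧-no (yes p) ¬p = contradiction p ¬p
⟦⟧-no (no _)  _  = refl

⟦⟧-× : {P Q : Set} (p : Dec P) (q : Dec Q) → ⟦ p ×-dec q ⟧ ≡ ⟦ p ⟧ * ⟦ q ⟧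
⟦⟧-× (yes p) (yes q) = refl
⟦⟧-× (yes p) (no q)  = refl
⟦⟧-× (no p)  q       = refl

⟦⟧-⊎ : {P Q : Set} (p : Dec P) (q : Dec Q) → ⟦ p ⊎-dec q ⟧ ≤ ⟦ p ⟧ + ⟦ q ⟧
⟦⟧-⊎ (yes p) q       = s≤s z≤n
⟦⟧-⊎ (no p)  (yes q) = ≤-refl
⟦⟧-⊎ (no p)  (no q)  = ≤-refl

# : {P : Pred A 0ℓ} → Decidable P → List A → ℕ
# P? xs = ∑ xs (λ x → ⟦ P? x ⟧)

length-filter≡# : {P : Pred A 0ℓ} (P? : Decidable P) → ∀ xs → length (filter P? xs) ≡ # P? xs
length-filter≡# P? []       = refl
length-filter≡# P? (x ∷ xs) with P? x
... | yes _ = cong suc (length-filter≡# P? xs)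
... | no  _ = length-filter≡# P? xs

#-complement : {P : Pred A 0ℓ} (P? : Decidable P) → ∀ xs → # (¬? ∘ P?) xs + # P? xs ≡ length xs
#-complement P? []       = refl
#-complement P? (x ∷ xs) with P? x
... | yes _ = trans (+-suc _ _) (cong suc (#-complement P? xs))
... | no  _ = cong suc (#-complement P? xs)

#-mono : {P Q : Pred A 0ℓ} (P? : Decidable P) (Q? : Decidable Q) → (∀ {x} → P x → Q x) →
  ∀ xs → # P? xs ≤ # Q? xs
#-mono P? Q? f xs = ∑-mono xs λ {x} _ → ⟦⟧-mono (P? x) (Q? x) f

#≤length : {P : Pred A 0ℓ} (P? : Decidable P) → ∀ xs → # P? xs ≤ length xs
#≤length P? xs = ≤-trans (m≤n+m _ _) (≤-reflexive (#-complement P? xs))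

#-filter≤ : {P Q : Pred A 0ℓ} (P? : Decidable P) (Q? : Decidable Q) → ∀ xs → # P? (filter Q? xs) ≤ # P? xs
#-filter≤ P? Q? []       = z≤n
#-filter≤ P? Q? (x ∷ xs) with Q? x
... | yes _ = +-monoʳ-≤ ⟦ P? x ⟧ (#-filter≤ P? Q? xs)
... | no  _ = ≤-trans (#-filter≤ P? Q? xs) (m≤n+m _ ⟦ P? x ⟧)

#-⊎ : {P Q : Pred A 0ℓ} (P? : Decidable P) (Q? : Decidable Q) → ∀ xs →
  # (λ x → P? x ⊎-dec Q? x) xs ≤ # P? xs + # Q? xs
#-⊎ P? Q? xs = ≤-trans (∑-mono xs λ {x} _ → ⟦⟧-⊎ (P? x) (Q? x)) (≤-reflexive (∑-+ _ _ xs))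

#-any : {P : B → Pred A 0ℓ} (P? : ∀ b → Decidable (P b)) → ∀ bs xs →
  # (λ x → any? (λ b → P? b x) bs) xs ≤ ∑ bs (λ b → # (P? b) xs)
#-any P? []       xs = ≤-reflexive (trans (∑-const 0 xs) (*-zeroʳ (length xs)))
#-any P? (b ∷ bs) xs = begin
  # (λ x → any? (λ b → P? b x) (b ∷ bs)) xs
    ≤⟨ #-mono (λ x → any? (λ b → P? b x) (b ∷ bs)) (λ x → P? b x ⊎-dec any? (λ b → P? b x) bs)
         (λ { (here p) → inj₁ p ; (there p) → inj₂ p }) xs ⟩
  # (λ x → P? b x ⊎-dec any? (λ b → P? b x) bs) xs
    ≤⟨ #-⊎ (P? b) (λ x → any? (λ b → P? b x) bs) xs ⟩
  # (P? b) xs + # (λ x → any? (λ b → P? b x) bs) xs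
    ≤⟨ +-monoʳ-≤ (# (P? b) xs) (#-any P? bs xs) ⟩
  # (P? b) xs + ∑ bs (λ b → # (P? b) xs) ∎
  where open ≤-Reasoning

-- The union bound, with the denominator `q` cleared so that fractions of a set stay in ℕ.
#-any-bound : {P : B → Pred A 0ℓ} (P? : ∀ b → Decidable (P b)) (q M : ℕ) → ∀ bs xs →
  (∀ {b} → b ∈ bs → q * # (P? b) xs ≤ M) →
  q * # (λ x → any? (λ b → P? b x) bs) xs ≤ length bs * M
#-any-bound P? q M bs xs h = begin
  q * # (λ x → any? (λ b → P? b x) bs) xs ≤⟨ *-monoʳ-≤ q (#-any P? bs xs) ⟩
  q * ∑ bs (λ b → # (P? b) xs)            ≡⟨ ∑-*ˡ q _ bs ⟨
  ∑ bs (λ b → q * # (P? b) xs)            ≤⟨ ∑-bound bs h ⟩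
  length bs * M                           ∎
  where open ≤-Reasoning

#-zero : {P : Pred A 0ℓ} (P? : Decidable P) → ∀ {xs} → # P? xs ≡ 0 → ∀ {x} → x ∈ xs → ¬ P x
#-zero P? {x ∷ xs} e (here refl) p = contradiction (trans (sym (⟦⟧-yes (P? x) p)) (m+n≡0⇒m≡0 ⟦ P? x ⟧ e)) λ ()
#-zero P? {x ∷ xs} e (there i)   p = #-zero P? (m+n≡0⇒n≡0 ⟦ P? x ⟧ e) i p

#-pick : {P Q : Pred A 0ℓ} (P? : Decidable P) (Q? : Decidable Q) → ∀ xs →
  # Q? xs < # P? xs → ∃[ x ] x ∈ xs × P x × ¬ Q x
#-pick P? Q? (x ∷ xs) lt with P? x | Q? x
... | yes p | no ¬q = x , here refl , p , ¬q
... | yes p | yes q = let y , i , r = #-pick P? Q? xs (≤-pred lt) in y , there i , r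
... | no ¬p | yes q = let y , i , r = #-pick P? Q? xs (<⇒≤ lt) in y , there i , r
... | no ¬p | no ¬q = let y , i , r = #-pick P? Q? xs lt in y , there i , r

#-pick-outside : {Q : Pred A 0ℓ} (Q? : Decidable Q) → ∀ xs → # Q? xs < length xs → ∃[ x ] x ∈ xs × ¬ Q x
#-pick-outside Q? xs lt =
  let x , i , _ , ¬q = #-pick (λ _ → yes tt) Q? xs (subst (# Q? xs <_) (sym (trans (∑-const 1 xs) (*-identityʳ _))) lt)
  in x , i , ¬q

#-none : {P : Pred A 0ℓ} (P? : Decidable P) → ∀ xs → (∀ {x} → x ∈ xs → ¬ P x) → # P? xs ≡ 0
#-none P? []       h = refl
#-none P? (x ∷ xs) h = cong₂ _+_ (⟦⟧-no (P? x) (h (here refl))) (#-none P? xs (h ∘ there))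

#-≡ : (_≟ᴬ_ : DecidableEquality A) → ∀ {xs} → Unique xs → ∀ y → # (λ x → x ≟ᴬ y) xs ≤ 1
#-≡ _≟ᴬ_ []                     y = z≤n
#-≡ _≟ᴬ_ {x ∷ xs} (x∉xs ∷ u) y with x ≟ᴬ y
... | yes refl = ≤-reflexive (cong suc (#-none (_≟ᴬ y) xs λ {z} i e → All.lookup x∉xs i (sym e)))
... | no _     = #-≡ _≟ᴬ_ u y

-- Tuples with repetition, the sample space of independent draws.

tuples : List A → ℕ → List (List A)
tuples S zero    = [] ∷ []
tuples S (suc t) = cartesianProductWith _∷_ S (tuples S t)

∈-tuples : ∀ {S : List A} {W} → All (_∈ S) W → W ∈ tuples S (length W)
∈-tuples []       = here refl
∈-tuples (i ∷ is) = ∈-cartesianProductWith⁺ _∷_ i (∈-tuples is)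

-- Independence of the draws: the indicator of `all?` is the product of the indicators of the
-- entries, so the sum over tuples factors.
∑-tuples-all : {P : Pred A 0ℓ} (P? : Decidable P) → ∀ S t → # (all? P?) (tuples S t) ≡ # P? S ^ t
∑-tuples-all P? S zero    = refl
∑-tuples-all P? S (suc t) = begin
  ∑ (cartesianProductWith _∷_ S (tuples S t)) (λ W → ⟦ all? P? W ⟧)
    ≡⟨ ∑-cartesian _∷_ _ S (tuples S t) ⟩
  ∑ S (λ x → ∑ (tuples S t) (λ W → ⟦ all? P? (x ∷ W) ⟧))
    ≡⟨ ∑-cong S (λ x → ∑-cong (tuples S t) (λ W → ⟦all∷⟧ x W)) ⟩
  ∑ S (λ x → ∑ (tuples S t) (λ W → ⟦ P? x ⟧ * ⟦ all? P? W ⟧))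
    ≡⟨ ∑-cong S (λ x → trans (∑-*ˡ ⟦ P? x ⟧ _ (tuples S t)) (*-comm ⟦ P? x ⟧ _)) ⟩
  ∑ S (λ x → # (all? P?) (tuples S t) * ⟦ P? x ⟧)
    ≡⟨ ∑-*ˡ (# (all? P?) (tuples S t)) _ S ⟩
  # (all? P?) (tuples S t) * # P? S
    ≡⟨ trans (*-comm _ (# P? S)) (cong (# P? S *_) (∑-tuples-all P? S t)) ⟩
  # P? S * # P? S ^ t ∎
  where
  open ≡-Reasoning
  ⟦all∷⟧ : ∀ x W → ⟦ all? P? (x ∷ W) ⟧ ≡ ⟦ P? x ⟧ * ⟦ all? P? W ⟧
  ⟦all∷⟧ x W = trans
    (⟦⟧-cong (all? P? (x ∷ W)) (P? x ×-dec all? P? W) (λ { (p ∷ ps) → p , ps }) (λ (p , ps) → p ∷ ps))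
    (⟦⟧-× (P? x) (all? P? W))

length-tuples : ∀ (S : List A) t → length (tuples S t) ≡ length S ^ t
length-tuples S zero    = refl
length-tuples S (suc t) = trans (length-cartesian _∷_ S (tuples S t)) (cong (length S *_) (length-tuples S t))
  where
  length-cartesian : ∀ {A B C : Set} (h : A → B → C) xs ys →
    length (cartesianProductWith h xs ys) ≡ length xs * length ys
  length-cartesian h xs ys = begin
    length (cartesianProductWith h xs ys)                ≡⟨ *-identityʳ _ ⟨
    length (cartesianProductWith h xs ys) * 1            ≡⟨ ∑-const 1 (cartesianProductWith h xs ys) ⟨
    ∑ (cartesianProductWith h xs ys) (λ _ → 1)           ≡⟨ ∑-cartesian h _ xs ys ⟩
    ∑ xs (λ _ → ∑ ys (λ _ → 1))                          ≡⟨ ∑-const _ xs ⟩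
    length xs * ∑ ys (λ _ → 1)                           ≡⟨ cong (length xs *_) (trans (∑-const 1 ys) (*-identityʳ _)) ⟩
    length xs * length ys ∎
    where open ≡-Reasoning

nonempty⇒∈ : ∀ {xs : List A} → 0 < length xs → ∃[ x ] x ∈ xs
nonempty⇒∈ {xs = x ∷ _} _ = x , here refl

^-distribʳ-* : ∀ a b t → (a * b) ^ t ≡ a ^ t * b ^ t
^-distribʳ-* a b zero    = refl
^-distribʳ-* a b (suc t) = trans (cong (a * b *_) (^-distribʳ-* a b t)) (rearrange a b (a ^ t) (b ^ t))
  where
  rearrange : ∀ a b c d → a * b * (c * d) ≡ a * c * (b * d)
  rearrange = solve-∀

-- Dependent random choice.

module DependentChoice {A : Set} {E : A → A → Set} (E? : ∀ x y → Dec (E x y)) (S : List A) (q : ℕ) where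

  s : ℕ
  s = length S

  deg : A → ℕ
  deg v = # (E? v) S

  heavy? : ∀ v → Dec (s ≤ q * deg v)
  heavy? v = s ≤? q * deg v

  common? : ∀ W y → Dec (All (λ w → E w y) W)
  common? W y = all? (λ w → E? w y) W

  neighbourhood : List A → List A
  neighbourhood T = filter (λ v → all? (E? v) T) S

  -- In place of convexity, only heavy vertices are counted: each contributes at least `s ^ t` to
  -- the sum of `(q * deg v) ^ t`.
  heavy-moment : ∀ t → # heavy? S * s ^ t ≤ q ^ t * ∑ S (λ v → deg v ^ t)
  heavy-moment t = begin
    # heavy? S * s ^ t                ≡⟨ *-comm (# heavy? S) _ ⟩
    s ^ t * # heavy? S                ≡⟨ ∑-*ˡ (s ^ t) _ S ⟨
    ∑ S (λ v → s ^ t * ⟦ heavy? v ⟧)  ≤⟨ ∑-mono S (λ {v} _ → pointwise v (heavy? v)) ⟩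
    ∑ S (λ v → q ^ t * deg v ^ t)     ≡⟨ ∑-*ˡ (q ^ t) _ S ⟩
    q ^ t * ∑ S (λ v → deg v ^ t)     ∎
    where
    open ≤-Reasoning
    pointwise : ∀ v (h? : Dec (s ≤ q * deg v)) → s ^ t * ⟦ h? ⟧ ≤ q ^ t * deg v ^ t
    pointwise v (yes h) = begin
      s ^ t * 1         ≡⟨ *-identityʳ _ ⟩
      s ^ t             ≤⟨ ^-monoˡ-≤ t h ⟩
      (q * deg v) ^ t   ≡⟨ ^-distribʳ-* q (deg v) t ⟩
      q ^ t * deg v ^ t ∎
    pointwise v (no _)  = ≤-trans (≤-reflexive (*-zeroʳ (s ^ t))) z≤n

  -- Double counting of the pairs `T`, `v` with `v` joined to every entry of `T`.
  ∑-neighbourhoods : ∀ t → ∑ (tuples S t) (λ T → # (λ v → all? (E? v) T) S) ≡ ∑ S (λ v → deg v ^ t)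
  ∑-neighbourhoods t = trans (∑-swap _ (tuples S t) S) (∑-cong S (λ v → ∑-tuples-all (E? v) S t))

  module _ (n d : ℕ) where

    -- Taking `t = d + 1` balances the penalty `s` charged for each bad d-tuple: in total it is at
    -- most `s * s ^ d * n ^ t`, which averages to `n ^ t` per tuple `T`. In `Q`, the factor `q ^ t`
    -- comes from the degrees of the heavy vertices and one more `q` from their proportion in `S`.
    t Q : ℕ
    t = suc d
    Q = q ^ suc t

    bad? : ∀ W → Dec (# (common? W) S ≤ n)
    bad? W = # (common? W) S ≤? n

    -- The second half says that `W` lies in the neighbourhood of `T`, with the quantifiers
    -- exchanged so that for fixed `W` it is a condition on each entry of `T` and `∑-tuples-all`
    -- applies.
    badIn? : ∀ T W → Dec (# (common? W) S ≤ n × All (λ x → All (λ w → E w x) W) T)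
    badIn? T W = bad? W ×-dec all? (common? W) T

    -- For a bad `W` to lie in the neighbourhood of `T`, each entry of `T` must be one of the at
    -- most `n` common neighbours of `W`, which leaves at most `n ^ t` choices of `T`.
    ∑-bad : ∑ (tuples S t) (λ T → # (badIn? T) (tuples S d)) ≤ s ^ d * n ^ t
    ∑-bad = begin
      ∑ (tuples S t) (λ T → # (badIn? T) (tuples S d))
        ≡⟨ ∑-swap _ (tuples S t) (tuples S d) ⟩
      ∑ (tuples S d) (λ W → ∑ (tuples S t) (λ T → ⟦ badIn? T W ⟧))
        ≤⟨ ∑-bound (tuples S d) (λ {W} _ → pointwise W) ⟩
      length (tuples S d) * n ^ t
        ≡⟨ cong (_* n ^ t) (length-tuples S d) ⟩
      s ^ d * n ^ t ∎
      where
      open ≤-Reasoning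
      pointwise : ∀ W → # (λ T → badIn? T W) (tuples S t) ≤ n ^ t
      pointwise W with bad? W
      ... | yes b = begin
        # (λ T → badIn? T W) (tuples S t)
          ≤⟨ #-mono (λ T → badIn? T W) (all? (common? W)) proj₂ (tuples S t) ⟩
        # (all? (common? W)) (tuples S t) ≡⟨ ∑-tuples-all (common? W) S t ⟩
        # (common? W) S ^ t               ≤⟨ ^-monoˡ-≤ t b ⟩
        n ^ t ∎
      ... | no ¬b = ≤-trans (≤-reflexive (#-none (λ T → badIn? T W) (tuples S t) (λ _ → ¬b ∘ proj₁))) z≤n

    -- Some T is at least average for |N(T)| − s · #{bad W inside N(T)}; as |N(T)| ≤ s, positivity of this
    -- quantity rules out every bad W. The inequality f T ≤ g T states this scaled by Q, without subtraction.
    dependentChoice : 0 < s → Q * n ^ t + Q * n ^ t ≤ s → s ≤ q * # heavy? S →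
      ∃[ T ] s ≤ 2 * Q * length (neighbourhood T) ×
             (∀ W → length W ≡ d → All (_∈ neighbourhood T) W → n < # (common? W) S)
    dependentChoice s>0 small h = T , large , rich
      where
      a b f g : List A → ℕ
      a T = # (λ v → all? (E? v) T) S
      b T = # (badIn? T) (tuples S d)
      f T = s + Q * s * b T
      g T = Q * a T + Q * n ^ t

      moment : s ^ t * s ≤ Q * ∑ (tuples S t) a
      moment = begin
        s ^ t * s                             ≤⟨ *-monoʳ-≤ (s ^ t) h ⟩
        s ^ t * (q * # heavy? S)              ≡⟨ rearrange (s ^ t) q (# heavy? S) ⟩
        q * (# heavy? S * s ^ t)              ≤⟨ *-monoʳ-≤ q (heavy-moment t) ⟩
        q * (q ^ t * ∑ S (λ v → deg v ^ t))   ≡⟨ *-assoc q _ _ ⟨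
        Q * ∑ S (λ v → deg v ^ t)             ≡⟨ cong (Q *_) (∑-neighbourhoods t) ⟨
        Q * ∑ (tuples S t) a                  ∎
        where
        open ≤-Reasoning
        rearrange : ∀ a b c → a * (b * c) ≡ b * (c * a)
        rearrange = solve-∀

      total : ∑ (tuples S t) f ≤ ∑ (tuples S t) g
      total = begin
        ∑ (tuples S t) f
          ≡⟨ ∑-+ _ _ (tuples S t) ⟩
        ∑ (tuples S t) (λ _ → s) + ∑ (tuples S t) (λ T → Q * s * b T)
          ≡⟨ cong₂ _+_ (trans (∑-const s (tuples S t)) (cong (_* s) (length-tuples S t))) (∑-*ˡ (Q * s) b (tuples S t)) ⟩
        s ^ t * s + Q * s * ∑ (tuples S t) b
          ≤⟨ +-mono-≤ moment (*-monoʳ-≤ (Q * s) ∑-bad) ⟩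
        Q * ∑ (tuples S t) a + Q * s * (s ^ d * n ^ t)
          ≡⟨ cong (Q * ∑ (tuples S t) a +_) (rearrange Q s (s ^ d) (n ^ t)) ⟩
        Q * ∑ (tuples S t) a + s ^ t * (Q * n ^ t)
          ≡⟨ cong₂ _+_ (∑-*ˡ Q a (tuples S t)) (trans (∑-const _ (tuples S t)) (cong (_* (Q * n ^ t)) (length-tuples S t))) ⟨
        ∑ (tuples S t) (λ T → Q * a T) + ∑ (tuples S t) (λ _ → Q * n ^ t)
          ≡⟨ ∑-+ _ _ (tuples S t) ⟨
        ∑ (tuples S t) g ∎
        where
        open ≤-Reasoning
        rearrange : ∀ Q s x y → Q * s * (x * y) ≡ s * x * (Q * y)
        rearrange = solve-∀

      tuples-nonempty : 0 < length (tuples S t)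
      tuples-nonempty = subst (0 <_) (sym (length-tuples S t)) (subst (_≤ s ^ t) (^-zeroˡ t) (^-monoˡ-≤ t s>0))

      averaged : ∃[ T ] f T ≤ g T
      averaged = ∑-averaging f g (tuples S t) tuples-nonempty total

      T : List A
      T = proj₁ averaged

      -- As `a T ≤ s`, a single bad tuple would force `s ≤ Q * n ^ t`, contradicting `small` and
      -- `s>0`.
      bT≡0 : b T ≡ 0
      bT≡0 = n<1⇒n≡0 (≰⇒> λ b≥1 →
        let s≤x = +-cancelˡ-≤ (Q * s) s (Q * n ^ t) (begin
              Q * s + s                    ≡⟨ +-comm (Q * s) s ⟩
              s + Q * s
                ≤⟨ +-monoʳ-≤ s (≤-trans (≤-reflexive (sym (*-identityʳ (Q * s)))) (*-monoʳ-≤ (Q * s) b≥1)) ⟩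
              f T                          ≤⟨ proj₂ averaged ⟩
              Q * a T + Q * n ^ t          ≤⟨ +-monoˡ-≤ _ (*-monoʳ-≤ Q (#≤length (λ v → all? (E? v) T) S)) ⟩
              Q * s + Q * n ^ t            ∎)
            x≤0 = +-cancelˡ-≤ (Q * n ^ t) (Q * n ^ t) 0
                    (≤-trans small (≤-trans s≤x (≤-reflexive (sym (+-identityʳ (Q * n ^ t))))))
        in <⇒≱ s>0 (≤-trans s≤x x≤0))
        where open ≤-Reasoning

      -- Doubling `s ≤ g T` lets `small` absorb both error terms into one copy of `s`.
      large : s ≤ 2 * Q * length (neighbourhood T)
      large = +-cancelˡ-≤ s s _ (begin
        s + s                                          ≤⟨ +-mono-≤ fT fT ⟩
        Q * a T + Q * n ^ t + (Q * a T + Q * n ^ t)    ≡⟨ regroup (Q * n ^ t) Q (a T) ⟩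
        Q * n ^ t + Q * n ^ t + 2 * Q * a T            ≤⟨ +-monoˡ-≤ _ small ⟩
        s + 2 * Q * a T
          ≡⟨ cong (λ l → s + 2 * Q * l) (length-filter≡# (λ v → all? (E? v) T) S) ⟨
        s + 2 * Q * length (neighbourhood T)           ∎)
        where
        open ≤-Reasoning
        fT : s ≤ Q * a T + Q * n ^ t
        fT = ≤-trans (m≤m+n s _) (proj₂ averaged)
        regroup : ∀ x Q a → Q * a + x + (Q * a + x) ≡ x + x + 2 * Q * a
        regroup = solve-∀

      rich : ∀ W → length W ≡ d → All (_∈ neighbourhood T) W → n < # (common? W) S
      rich W refl W⊆ = ≰⇒> λ bad →
        #-zero (badIn? T) bT≡0 (∈-tuples (All.map (proj₁ ∘ unfilter) W⊆))
          (bad , All-swap (All.map (proj₂ ∘ unfilter) W⊆))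
        where
        unfilter : ∀ {x} → x ∈ neighbourhood T → x ∈ S × All (E x) T
        unfilter = ∈-filter⁻ (λ v → all? (E? v) T)

-- Edge colourings and rainbow sets.

module Colouring {V : Set} (_≟ⱽ_ : DecidableEquality V) (c : V → V → ℕ) (c-sym : ∀ x y → c x y ≡ c y x) where

  infix 4 _≢?_
  _≢?_ : ∀ (x y : V) → Dec (x ≢ y)
  x ≢? y = ¬? (x ≟ⱽ y)

  -- The diagonal of `c` carries arbitrary values, hence the condition `x ≢ y`.
  Edge : ℕ → V → V → Set
  Edge a x y = x ≢ y × c x y ≡ a

  Edge? : ∀ a x y → Dec (Edge a x y)
  Edge? a x y = x ≢? y ×-dec c x y ≟ a

  Edge-sym : ∀ {a x y} → Edge a x y → Edge a y x
  Edge-sym (x≢y , e) = x≢y ∘ sym , trans (c-sym _ _) e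

  RainbowOn : List V → Set
  RainbowOn xs = ∀ {x y x' y'} → x ∈ xs → y ∈ xs → x' ∈ xs → y' ∈ xs → x ≢ y → x' ≢ y' →
    c x y ≡ c x' y' → (x ≡ x' × y ≡ y') ⊎ (x ≡ y' × y ≡ x')

  Agree : V → V → V → Set
  Agree x x' y = x ≢ y × x' ≢ y × c x y ≡ c x' y

  Agree? : ∀ x x' y → Dec (Agree x x' y)
  Agree? x x' y = x ≢? y ×-dec x' ≢? y ×-dec c x y ≟ c x' y

  -- A colour repeated after adding `z` occurs on two edges at `z`, which the agreement hypothesis
  -- excludes, or on an edge at `z` and an old edge, which the last hypothesis excludes. The cases
  -- of `go` are the positions of `z` among the four endpoints.
  RainbowOn-extend : ∀ {xs z} → RainbowOn xs → z ∉ xs →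
    (∀ {x x'} → x ∈ xs → x' ∈ xs → x ≢ x' → ¬ Agree x x' z) →
    (∀ {x x' x''} → x ∈ xs → x' ∈ xs → x'' ∈ xs → ¬ Edge (c x' x'') x z) →
    RainbowOn (z ∷ xs)
  RainbowOn-extend {xs} {z} rb z∉ ¬agree ¬old = go
    where
    SamePair : V → V → V → V → Set
    SamePair x y x' y' = (x ≡ x' × y ≡ y') ⊎ (x ≡ y' × y ≡ x')

    swapˡ : ∀ {x y x' y'} → SamePair x y x' y' → SamePair y x x' y'
    swapˡ (inj₁ (p , q)) = inj₂ (q , p)
    swapˡ (inj₂ (p , q)) = inj₁ (q , p)

    swapʳ : ∀ {x y x' y'} → SamePair x y x' y' → SamePair x y y' x'
    swapʳ (inj₁ (p , q)) = inj₂ (p , q)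
    swapʳ (inj₂ (p , q)) = inj₁ (p , q)

    z≢ : ∀ {x} → x ∈ xs → x ≢ z
    z≢ i refl = z∉ i

    newOld : ∀ {x x' x''} → x ∈ xs → x' ∈ xs → x'' ∈ xs → c z x ≢ c x' x''
    newOld i j k e = ¬old i j k (z≢ i , trans (c-sym _ _) e)

    newNew : ∀ {y y'} → y ∈ xs → y' ∈ xs → c z y ≡ c z y' → y ≡ y'
    newNew {y} {y'} i j e with y ≟ⱽ y'
    ... | yes p  = p
    ... | no y≢y' = contradiction (z≢ i , z≢ j , trans (c-sym _ _) (trans e (c-sym _ _))) (¬agree i j y≢y')

    go : RainbowOn (z ∷ xs)
    go (here refl) (here refl) _ _ d _ _ = contradiction refl d
    go _ _ (here refl) (here refl) _ d _ = contradiction refl d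
    go (there i) (there j) (there k) (there l) d d' e = rb i j k l d d' e
    go (here refl) (there j) (there k) (there l) _ _ e = contradiction e (newOld j k l)
    go (there i) (here refl) (there k) (there l) _ _ e = contradiction (trans (c-sym _ _) e) (newOld i k l)
    go (there i) (there j) (here refl) (there l) _ _ e = contradiction (sym e) (newOld l i j)
    go (there i) (there j) (there k) (here refl) _ _ e = contradiction (trans (c-sym _ _) (sym e)) (newOld k i j)
    go (here refl) (there j) (here refl) (there l) _ _ e = inj₁ (refl , newNew j l e)
    go (here refl) (there j) (there k) (here refl) _ _ e = inj₂ (refl , newNew j k (trans e (c-sym _ _)))
    go (there i) (here refl) (here refl) (there l) _ _ e = inj₂ (newNew i l (trans (c-sym _ _) e) , refl)
    go (there i) (here refl) (there k) (here refl) _ _ e =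
      inj₁ (newNew i k (trans (c-sym _ _) (trans e (c-sym _ _))) , refl)

  -- Greedy rainbow clique under small colour degrees.

  module LocallyBounded (R : List V) (R! : Unique R) (p s n : ℕ) (s>0 : 0 < s) (R≤s : length R ≤ s)
    (p²≤s : p * p ≤ s)
    (bounded : ∀ a {x} → x ∈ R → p * p * # (Edge? a x) R ≤ s)
    (room : n * (p * s + (p * s + (n * (p * s) + n * (n * (p * s))))) < p * p * length R) where

    codegree : V → V → ℕ
    codegree x x' = # (Agree? x x') R

    -- Clashing pairs are kept out of the clique: for fixed x and x', a colour degree bound does not limit the number of
    -- z with c x z = c x' z. Summed over x' it does, so few x' clash with a given x.
    Clash : V → V → Set
    Clash x x' = s < p * codegree x x'

    Clash? : ∀ x x' → Dec (Clash x x')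
    Clash? x x' = s <? p * codegree x x'

    Clash-sym : ∀ {x x'} → Clash x x' → Clash x' x
    Clash-sym {x} {x'} h = <-≤-trans h (*-monoʳ-≤ p
      (#-mono (Agree? x x') (Agree? x' x) (λ (u , v , e) → v , u , sym e) R))

    -- Double counting over `y`: the `x'` agreeing with `x` at `y` are neighbours of `y` in colour
    -- `c x y`, and `bounded` limits their number.
    ∑-codegree : ∀ {x} → x ∈ R → p * p * ∑ R (codegree x) ≤ length R * s
    ∑-codegree {x} x∈R = begin
      p * p * ∑ R (codegree x)
        ≡⟨ cong (p * p *_) (∑-swap _ R R) ⟩
      p * p * ∑ R (λ y → # (λ x' → Agree? x x' y) R)
        ≡⟨ ∑-*ˡ (p * p) _ R ⟨
      ∑ R (λ y → p * p * # (λ x' → Agree? x x' y) R)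
        ≤⟨ ∑-bound R pointwise ⟩
      length R * s ∎
      where
      open ≤-Reasoning
      pointwise : ∀ {y} → y ∈ R → p * p * # (λ x' → Agree? x x' y) R ≤ s
      pointwise {y} y∈R = ≤-trans
        (*-monoʳ-≤ (p * p) (#-mono (λ x' → Agree? x x' y) (Edge? (c x y) y)
          (λ (_ , x'≢y , e) → x'≢y ∘ sym , trans (c-sym _ _) (sym e)) R))
        (bounded (c x y) y∈R)

    -- Markov's inequality: the average codegree is at most s/p², so at most s/p vertices have
    -- codegree above s/p. This square-root loss is why the colour degrees are bounded with `p * p`.
    #-Clash : ∀ {x} → x ∈ R → p * p * # (Clash? x) R ≤ p * s
    #-Clash {x} x∈R = *-cancelʳ-≤ _ _ s {{>-nonZero s>0}} (begin
      p * p * # (Clash? x) R * s            ≡⟨ l₁ p s (# (Clash? x) R) ⟩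
      p * (p * (s * # (Clash? x) R))        ≤⟨ *-monoʳ-≤ p (*-monoʳ-≤ p markov) ⟩
      p * (p * (p * ∑ R (codegree x)))      ≡⟨ l₂ p (∑ R (codegree x)) ⟩
      p * (p * p * ∑ R (codegree x))        ≤⟨ *-monoʳ-≤ p (∑-codegree x∈R) ⟩
      p * (length R * s)                    ≤⟨ *-monoʳ-≤ p (*-monoˡ-≤ s R≤s) ⟩
      p * (s * s)                           ≡⟨ *-assoc p s s ⟨
      p * s * s                             ∎)
      where
      open ≤-Reasoning
      l₁ : ∀ p s k → p * p * k * s ≡ p * (p * (s * k))
      l₁ = solve-∀
      l₂ : ∀ p k → p * (p * (p * k)) ≡ p * (p * p * k)
      l₂ = solve-∀
      pointwise : ∀ x' → s * ⟦ Clash? x x' ⟧ ≤ p * codegree x x'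
      pointwise x' with Clash? x x'
      ... | yes h = ≤-trans (≤-reflexive (trans (cong (s *_) (⟦⟧-yes (Clash? x x') h)) (*-identityʳ s))) (<⇒≤ h)
      ... | no ¬h = ≤-trans (≤-reflexive (trans (cong (s *_) (⟦⟧-no (Clash? x x') ¬h)) (*-zeroʳ s))) z≤n
      markov : s * # (Clash? x) R ≤ p * ∑ R (codegree x)
      markov = begin
        s * # (Clash? x) R                  ≡⟨ ∑-*ˡ s _ R ⟨
        ∑ R (λ x' → s * ⟦ Clash? x x' ⟧)    ≤⟨ ∑-mono R (λ {x'} _ → pointwise x') ⟩
        ∑ R (λ x' → p * codegree x x')      ≡⟨ ∑-*ˡ p _ R ⟩
        p * ∑ R (codegree x)                ∎

    record Partial (k : ℕ) : Set where
      field
        xs       : List V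
        size     : length xs ≡ k
        unique   : Unique xs
        ⊆R       : ∀ {x} → x ∈ xs → x ∈ R
        noClash  : ∀ {x x'} → x ∈ xs → x' ∈ xs → x ≢ x' → ¬ Clash x x'
        rainbow  : RainbowOn xs

    -- `room` excludes `p = 0`, so bounds by `s` can be relaxed to the common unit `p * s`.
    s≤ps : s ≤ p * s
    s≤ps = m≤n*m s p {{≢-nonZero λ p≡0 →
      m<n⇒n≢0 room (cong (λ p → p * p * length R) p≡0)}}

    extend : ∀ {k} → k < n → Partial k → Partial (suc k)
    extend {k} k<n P = record
      { xs = z ∷ xs ; size = cong suc size
      ; unique = All.tabulate (λ i e → z∉ (subst (_∈ xs) (sym e) i)) ∷ unique
      ; ⊆R = λ { (here refl) → z∈R ; (there i) → ⊆R i }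
      ; noClash = λ { (here refl) (here refl) d → contradiction refl d
                    ; (here refl) (there j) _ → ¬z-clash j ∘ Clash-sym
                    ; (there i) (here refl) _ → ¬z-clash i
                    ; (there i) (there j) d → noClash i j d }
      ; rainbow = RainbowOn-extend rainbow z∉
          (λ i j d e → ¬obs (lose i (inj₂ (inj₂ (inj₁ (lose j (d , e)))))))
          (λ i j k e → ¬obs (lose i (inj₂ (inj₂ (inj₂ (lose j (lose k e))))))) }
      where
      open Partial P
      -- `x ≢ x'` is required because `x` agrees with itself at every other vertex, and `x'` will
      -- range over all of `xs`.
      AgreeNeq? : ∀ x x' z → Dec (x ≢ x' × Agree x x' z)
      AgreeNeq? x x' z = x ≢? x' ×-dec Agree? x x' z

      Repeats? : ∀ x x' z → Dec (Any (λ x'' → Edge (c x' x'') x z) xs)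
      Repeats? x x' z = any? (λ x'' → Edge? (c x' x'') x z) xs

      -- The four alternatives match the four summands of `room`: `z` is already taken, clashes with
      -- `x`, creates two new edges of one colour, or repeats the colour of an old pair.
      Obstacle : V → V → Set
      Obstacle x z = z ≡ x ⊎ Clash x z ⊎ Any (λ x' → x ≢ x' × Agree x x' z) xs
                     ⊎ Any (λ x' → Any (λ x'' → Edge (c x' x'') x z) xs) xs

      agrees? : ∀ x z → Dec (Any (λ x' → x ≢ x' × Agree x x' z) xs)
      agrees? x z = any? (λ x' → AgreeNeq? x x' z) xs

      repeats? : ∀ x z → Dec (Any (λ x' → Any (λ x'' → Edge (c x' x'') x z) xs) xs)
      repeats? x z = any? (λ x' → Repeats? x x' z) xs

      obstacle? : ∀ x z → Dec (Obstacle x z)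
      obstacle? x z = z ≟ⱽ x ⊎-dec Clash? x z ⊎-dec agrees? x z ⊎-dec repeats? x z

      M : ℕ
      M = p * s

      agrees-bound : ∀ {x} → x ∈ xs → p * p * # (agrees? x) R ≤ k * M
      agrees-bound {x} i = subst (λ k → p * p * # (agrees? x) R ≤ k * M) size
        (#-any-bound (AgreeNeq? x) (p * p) M xs R one)
        where
        open ≤-Reasoning
        one : ∀ {x'} → x' ∈ xs → p * p * # (AgreeNeq? x x') R ≤ M
        one {x'} j = byCases (x ≟ⱽ x')
          where
          byCases : Dec (x ≡ x') → p * p * # (AgreeNeq? x x') R ≤ M
          byCases (yes e) = ≤-trans (≤-reflexive (trans (cong (p * p *_)
            (#-none (AgreeNeq? x x') R (λ _ (d , _) → d e))) (*-zeroʳ (p * p)))) z≤n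
          byCases (no d) = begin
            p * p * # (AgreeNeq? x x') R ≤⟨ *-monoʳ-≤ (p * p) (#-mono (AgreeNeq? x x') (Agree? x x') proj₂ R) ⟩
            p * p * codegree x x'        ≡⟨ *-assoc p p _ ⟩
            p * (p * codegree x x')      ≤⟨ *-monoʳ-≤ p (≮⇒≥ (noClash i j d)) ⟩
            p * s                        ∎

      repeats-bound : ∀ {x} → x ∈ xs → p * p * # (repeats? x) R ≤ k * (k * M)
      repeats-bound {x} i = subst (λ k → p * p * # (repeats? x) R ≤ k * (k * M)) size
        (#-any-bound (Repeats? x) (p * p) (length xs * M) xs R λ {x'} _ →
          #-any-bound (λ x'' → Edge? (c x' x'') x) (p * p) M xs R λ _ →
            ≤-trans (bounded _ (⊆R i)) s≤ps)

      obstacle-bound : ∀ {x} → x ∈ xs → p * p * # (obstacle? x) R ≤ M + (M + (k * M + k * (k * M)))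
      obstacle-bound {x} i =
        split (_≟ⱽ x) (λ z → Clash? x z ⊎-dec agrees? x z ⊎-dec repeats? x z)
          -- `R` contains `x` at most once, and `p²≤s` charges this single vertex to one unit `M`.
          (≤-trans (*-monoʳ-≤ (p * p) (#-≡ _≟ⱽ_ R! x)) (≤-trans (≤-reflexive (*-identityʳ (p * p))) (≤-trans p²≤s s≤ps)))
          (split (Clash? x) (λ z → agrees? x z ⊎-dec repeats? x z) (#-Clash (⊆R i))
            (split (agrees? x) (repeats? x) (agrees-bound i) (repeats-bound i)))
        where
        split : ∀ {P Q : Pred V 0ℓ} (P? : Decidable P) (Q? : Decidable Q) {u v} →
          p * p * # P? R ≤ u → p * p * # Q? R ≤ v → p * p * # (λ z → P? z ⊎-dec Q? z) R ≤ u + v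
        split P? Q? hu hv = ≤-trans (*-monoʳ-≤ (p * p) (#-⊎ P? Q? R))
          (≤-trans (≤-reflexive (*-distribˡ-+ (p * p) (# P? R) (# Q? R))) (+-mono-≤ hu hv))

      obs? : ∀ z → Dec (Any (λ x → Obstacle x z) xs)
      obs? z = any? (λ x → obstacle? x z) xs

      fewer : # obs? R < length R
      fewer = *-cancelˡ-< (p * p) _ _ (begin-strict
        p * p * # obs? R
          ≤⟨ #-any-bound obstacle? (p * p) _ xs R obstacle-bound ⟩
        length xs * (M + (M + (k * M + k * (k * M))))
          ≡⟨ cong (_* (M + (M + (k * M + k * (k * M))))) size ⟩
        k * (M + (M + (k * M + k * (k * M))))
          ≤⟨ *-mono-≤ k≤n (+-monoʳ-≤ M (+-monoʳ-≤ M (+-mono-≤ (*-monoˡ-≤ M k≤n) (*-mono-≤ k≤n (*-monoˡ-≤ M k≤n))))) ⟩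
        n * (M + (M + (n * M + n * (n * M))))
          <⟨ room ⟩
        p * p * length R ∎)
        where
        open ≤-Reasoning
        k≤n : k ≤ n
        k≤n = <⇒≤ k<n

      choice : ∃[ z ] z ∈ R × ¬ Any (λ x → Obstacle x z) xs
      choice = #-pick-outside obs? R fewer

      z : V
      z = proj₁ choice
      z∈R : z ∈ R
      z∈R = proj₁ (proj₂ choice)
      ¬obs : ¬ Any (λ x → Obstacle x z) xs
      ¬obs = proj₂ (proj₂ choice)

      z∉ : z ∉ xs
      z∉ i = ¬obs (lose i (inj₁ refl))

      ¬z-clash : ∀ {x} → x ∈ xs → ¬ Clash x z
      ¬z-clash i h = ¬obs (lose i (inj₂ (inj₁ h)))

    partial : ∀ {k} → k ≤ n → Partial k
    partial {zero}  _   = record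
      { xs = [] ; size = refl ; unique = [] ; ⊆R = λ () ; noClash = λ () ; rainbow = λ () }
    partial {suc k} k<n = extend k<n (partial (<⇒≤ k<n))

    rainbowClique : ∃[ xs ] length xs ≡ n × Unique xs × RainbowOn xs
    rainbowClique = xs , size , unique , rainbow
      where open Partial (partial ≤-refl)

  RainbowClique : ℕ → Set
  RainbowClique n = ∃[ xs ] length xs ≡ n × Unique xs × RainbowOn xs

  -- Chains of star and dependent-choice steps.

  module Chains (n Δ : ℕ) where

    -- Z is the set of vertices already taken by an embedding.
    Rich : ℕ → List V → List V → Set
    Rich a S' S = ∀ W Z → length W ≤ Δ → All (_∈ S') W → length Z ≤ n →
      ∃[ x ] x ∈ S × x ∉ Z × All (λ w → Edge a w x) W

    -- drc steps come from dependent random choice; full closes a chain once n colours have been used.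
    data Chain (U : List ℕ) (S : List V) : ℕ → Set where
      full : ∀ {k} → n ≤ length U → Chain U S k
      end  : Chain U S 0
      star : ∀ {k a v S'} → v ∈ S → a ∉ U → S' ⊆ S → (∀ {w} → w ∈ S' → Edge a v w) →
             Chain (a ∷ U) S' k → Chain U S (suc k)
      drc  : ∀ {k a S'} → a ∈ U → S' ⊆ S → Rich a S' S → Chain U S' k → Chain U S (suc k)

    stars : ∀ {U S k} → Chain U S k → List (V × ℕ)
    stars (full _)                       = []
    stars end                            = []
    stars (star {a = a} {v} _ _ _ _ ch)  = (v , a) ∷ stars ch
    stars (drc _ _ _ ch)                 = stars ch

    drcs : ∀ {U S k} → Chain U S k → List ℕ
    drcs (full _)                = []
    drcs end                     = []
    drcs (star _ _ _ _ ch)       = drcs ch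
    drcs (drc {a = a} _ _ _ ch)  = a ∷ drcs ch

    Forward : V × ℕ → V × ℕ → Set
    Forward (v , a) (w , b) = a ≢ b × Edge a v w

    -- Sets only shrink and `U` only grows along a chain, so every later star has its centre in the
    -- current set and a colour not yet used.
    stars-new : ∀ {U S k} (ch : Chain U S k) → All (λ (v , a) → v ∈ S × a ∉ U) (stars ch)
    stars-new (full _)                  = []
    stars-new end                       = []
    stars-new (star v∈S a∉U S'⊆S _ ch)  =
      (v∈S , a∉U) ∷ All.map (λ (w∈S' , b∉) → S'⊆S w∈S' , b∉ ∘ there) (stars-new ch)
    stars-new (drc _ S'⊆S _ ch)         = All.map (λ (w∈S' , b∉) → S'⊆S w∈S' , b∉) (stars-new ch)

    stars-forward : ∀ {U S k} (ch : Chain U S k) → AllPairs Forward (stars ch)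
    stars-forward (full _)             = []
    stars-forward end                  = []
    stars-forward (star _ _ _ edge ch) =
      All.map (λ (w∈S' , b∉) → (λ a≡b → b∉ (here (sym a≡b))) , edge w∈S') (stars-new ch) ∷ stars-forward ch
    stars-forward (drc _ _ _ ch)       = stars-forward ch

    -- Each star adds one colour, so the sum of `length (stars ch)` and `length U` is the number of
    -- colours present when the chain stops; a chain stopped by `end` has made all `k` steps.
    chain-length : ∀ {U S k} (ch : Chain U S k) →
      n ≤ length (stars ch) + length U ⊎ length (stars ch) + length (drcs ch) ≡ k
    chain-length (full h)           = inj₁ h
    chain-length end                = inj₂ refl
    chain-length {U} (star _ _ _ _ ch) with chain-length ch
    ... | inj₁ h = inj₁ (≤-trans h (≤-reflexive (+-suc _ (length U))))
    ... | inj₂ e = inj₂ (cong suc e)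
    chain-length (drc _ _ _ ch) with chain-length ch
    ... | inj₁ h = inj₁ h
    ... | inj₂ e = inj₂ (trans (+-suc _ _) (cong suc e))

    -- A drc step takes its colour from the current list, and only star steps enlarge that list.
    drcs-colours : ∀ {U S k} (ch : Chain U S k) {a} → a ∈ drcs ch → a ∈ U ⊎ a ∈ map proj₂ (stars ch)
    drcs-colours (star _ _ _ _ ch) i with drcs-colours ch i
    ... | inj₁ (here e)  = inj₂ (here e)
    ... | inj₁ (there j) = inj₁ j
    ... | inj₂ j         = inj₂ (there j)
    drcs-colours (drc a∈U _ _ ch) (here refl) = inj₁ a∈U
    drcs-colours (drc _ _ _ ch) (there i)     = drcs-colours ch i

    -- The drc steps of one colour `a`, outermost first; each level will receive one colour class of
    -- `H`.
    data Tower (a : ℕ) (S : List V) : ℕ → Set where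
      base : Tower a S 0
      step : ∀ {m S'} → S' ⊆ S → Rich a S' S → Tower a S' m → Tower a S (suc m)

    -- A larger outermost set only eases the demand `x ∈ S`. This allows `tower` to skip star steps
    -- and drc steps of other colours.
    Tower-mono : ∀ {a m S S'} → S' ⊆ S → Tower a S' m → Tower a S m
    Tower-mono i base          = base
    Tower-mono i (step j rich t) = step (i ∘ j)
      (λ W Z lW W⊆ lZ → let x , x∈ , r = rich W Z lW W⊆ lZ in x , i x∈ , r) t

    tower : ∀ {U S k} (ch : Chain U S k) a m → m ≤ # (a ≟_) (drcs ch) → Tower a S m
    tower _                  a zero    _  = base
    tower (star _ _ i _ ch)  a (suc m) h  = Tower-mono i (tower ch a (suc m) h)
    tower {S = S} (drc {a = b} _ i rich ch) a (suc m) h = byCases (a ≟ b) h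
      where
      byCases : (d : Dec (a ≡ b)) → suc m ≤ ⟦ d ⟧ + # (a ≟_) (drcs ch) → Tower a S (suc m)
      byCases (yes refl) h = step i rich (tower ch a m (≤-pred h))
      byCases (no _)     h = Tower-mono i (tower ch a (suc m) h)

    -- Pigeonhole: fewer than `n` stars, with at most `χ` drc steps in each star colour, account for
    -- fewer than `n + n * χ` steps.
    starsOrTower : ∀ {S} χ → Chain [] S (n * suc χ) →
      (∃[ L ] n ≤ length L × AllPairs Forward L) ⊎ (∃[ a ] Tower a S χ)
    starsOrTower χ ch with n ≤? length (stars ch)
    ... | yes h = inj₁ (stars ch , h , stars-forward ch)
    ... | no ¬h with any? (λ a → χ ≤? # (a ≟_) (drcs ch)) (map proj₂ (stars ch))
    ...   | yes p = let a , _ , h = find p in inj₂ (a , tower ch a χ h)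
    ...   | no ¬p with chain-length ch
    -- The colour list starts empty, so a chain closed by `full` already has `n` stars.
    ...     | inj₁ h = contradiction (subst (n ≤_) (+-identityʳ _) h) ¬h
    ...     | inj₂ e = contradiction (begin-strict
      n * suc χ                                       ≡⟨ e ⟨
      length (stars ch) + length (drcs ch)            <⟨ +-monoˡ-< _ (≰⇒> ¬h) ⟩
      n + length (drcs ch)                            ≤⟨ +-monoʳ-≤ n few ⟩
      n + n * χ                                       ≡⟨ *-suc n χ ⟨
      n * suc χ                                       ∎) (<-irrefl refl)
      where
      open ≤-Reasoning
      colours : List ℕ
      colours = map proj₂ (stars ch)

      -- As no colour is present initially, each drc step can be counted under a star of the same
      -- colour.
      few : length (drcs ch) ≤ n * χ
      few = begin
        length (drcs ch)                                             ≡⟨ *-identityʳ _ ⟨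
        length (drcs ch) * 1                                         ≡⟨ ∑-const 1 (drcs ch) ⟨
        ∑ (drcs ch) (λ _ → 1)                                        ≤⟨ ∑-mono (drcs ch) occurs ⟩
        ∑ (drcs ch) (λ b → # (_≟ b) colours)                ≡⟨ ∑-swap _ (drcs ch) colours ⟩
        ∑ colours (λ a → # (a ≟_) (drcs ch))                ≤⟨ ∑-bound colours (λ i → <⇒≤ (≰⇒> (¬p ∘ lose i))) ⟩
        length colours * χ                                           ≡⟨ cong (_* χ) (length-map proj₂ (stars ch)) ⟩
        length (stars ch) * χ                                        ≤⟨ *-monoˡ-≤ χ (≰⇒≥ ¬h) ⟩
        n * χ                                                        ∎
        where
        occurs : ∀ {b} → b ∈ drcs ch → 1 ≤ # (_≟ b) colours
        occurs {b} i with drcs-colours ch i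
        ... | inj₂ j = n≢0⇒n>0 λ z → #-zero (_≟ b) z j refl

    -- Building a chain or finding a rainbow clique.

    module Build (p : ℕ) (n>0 : 0 < n) (numeric : n * (p + (p + (n * p + n * (n * p)))) + n < p * p) where

      -- `cost` dominates the shrinking factors of both steps, `q` for a star and `2 * Q` for a drc;
      -- its factor `n ^ t` makes `cost ≤ s` the smallness hypothesis of `dependentChoice`.
      q t Q cost : ℕ
      q = p * p
      t = suc Δ
      Q = q ^ suc t
      cost = 2 * Q * n ^ t

      instance
        q≢0 : NonZero q
        q≢0 = >-nonZero (≤-<-trans z≤n numeric)

      1≤n^t : 1 ≤ n ^ t
      1≤n^t = subst (_≤ n ^ t) (^-zeroˡ t) (^-monoˡ-≤ t n>0)

      2Q≤cost : 2 * Q ≤ cost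
      2Q≤cost = subst (_≤ cost) (*-identityʳ (2 * Q)) (*-monoʳ-≤ (2 * Q) 1≤n^t)

      q≤cost : q ≤ cost
      q≤cost = begin
        q      ≤⟨ m≤m*n q (q ^ t) {{m^n≢0 q t}} ⟩
        Q      ≤⟨ m≤n*m Q 2 ⟩
        2 * Q  ≤⟨ 2Q≤cost ⟩
        cost      ∎
        where open ≤-Reasoning

      instance
        cost≢0 : NonZero cost
        cost≢0 = >-nonZero (<-≤-trans (≤-<-trans z≤n numeric) q≤cost)

      module _ (U : List ℕ) (S : List V) (S! : Unique S) where
        open module DC (a : ℕ) = DependentChoice (Edge? a) S q using (heavy?; neighbourhood; common?)

        s : ℕ
        s = length S

        #-∈ : ∀ Z → # (λ x → any? (x ≟ⱽ_) Z) S ≤ length Z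
        #-∈ Z = ≤-trans (#-any (λ z x → x ≟ⱽ z) Z S)
          (≤-trans (∑-bound Z (λ {z} _ → #-≡ _≟ⱽ_ S! z)) (≤-reflexive (*-identityʳ _)))

        -- Of more than `n` common neighbours, `Z` can occupy at most `n`, because `S` has no
        -- duplicates.
        rich : ∀ a T → 0 < length (neighbourhood a T) →
          (∀ W → length W ≡ Δ → All (_∈ neighbourhood a T) W → n < # (common? a W) S) →
          Rich a (neighbourhood a T) S
        rich a T nonempty h W Z lW W⊆ lZ =
          let x , x∈S , joined , x∉Z = #-pick (common? a W⁺) (λ x → any? (x ≟ⱽ_) Z) S
                (≤-<-trans (≤-trans (#-∈ Z) lZ) (h W⁺ length-W⁺ (++⁺ W⊆ (replicate⁺ _ (proj₂ inhabitant)))))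
          in x , x∈S , x∉Z , ++⁻ˡ W joined
          where
          inhabitant : ∃[ x ] x ∈ neighbourhood a T
          inhabitant = nonempty⇒∈ nonempty

          -- Dependent choice speaks of lists of length exactly Δ, so W is padded.
          W⁺ : List V
          W⁺ = W ++ replicate (Δ ∸ length W) (proj₁ inhabitant)

          length-W⁺ : length W⁺ ≡ Δ
          length-W⁺ = trans (length-++ W)
            (trans (cong (length W +_) (length-replicate (Δ ∸ length W))) (m+[n∸m]≡n lW))

        -- Colours range over all of ℕ; looking for the new colour only among the values `c v w`
        -- with `v` and `w` in `S` keeps the search finite.
        rainbow : cost ≤ s → length U ≤ n →
          ¬ Any (λ v → Any (λ w → c v w ∉ U × s ≤ q * # (Edge? (c v w) v) S) S) S →
          ¬ Any (λ a → s ≤ q * # (heavy? a) S) U → RainbowClique n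
        rainbow cost≤s U≤n ¬star ¬dense = LocallyBounded.rainbowClique R (filter⁺ (λ v → ¬? (someHeavy? v)) S!)
          p s n s>0 (length-filter (λ v → ¬? (someHeavy? v)) S) (≤-trans q≤cost cost≤s) bounded room
          where
          open ≤-Reasoning

          s>0 : 0 < s
          s>0 = <-≤-trans (>-nonZero⁻¹ cost) cost≤s

          someHeavy? : ∀ v → Dec (Any (λ a → s ≤ q * # (Edge? a v) S) U)
          someHeavy? v = any? (λ a → heavy? a v) U

          R : List V
          R = filter (λ v → ¬? (someHeavy? v)) S

          unfilter : ∀ {v} → v ∈ R → v ∈ S × ¬ Any (λ a → s ≤ q * # (Edge? a v) S) U
          unfilter = ∈-filter⁻ (λ v → ¬? (someHeavy? v))

          -- A colour of `U` is excluded by the choice of `R`. A colour outside `U` has degree 0 at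
          -- `x` or equals `c x y` for some `y` in `S`, where `¬star` applies.
          light : ∀ a {x} → x ∈ R → ¬ (s ≤ q * # (Edge? a x) S)
          light a {x} x∈R h with any? (a ≟_) U | any? (Edge? a x) S
          ... | yes a∈U | _      = proj₂ (unfilter x∈R) (lose a∈U h)
          ... | no  a∉U | no ¬e  = <⇒≱ s>0 (≤-trans h (≤-reflexive
            (trans (cong (q *_) (#-none (Edge? a x) S (λ i → ¬e ∘ lose i))) (*-zeroʳ q))))
          ... | no  a∉U | yes e with find e
          ...   | y , y∈S , _ , refl = ¬star (lose (proj₁ (unfilter x∈R)) (lose y∈S (a∉U , h)))

          bounded : ∀ a {x} → x ∈ R → q * # (Edge? a x) R ≤ s
          bounded a {x} x∈R = begin
            q * # (Edge? a x) R ≤⟨ *-monoʳ-≤ q (#-filter≤ (Edge? a x) (λ v → ¬? (someHeavy? v)) S) ⟩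
            q * # (Edge? a x) S ≤⟨ ≰⇒≥ (light a x∈R) ⟩
            s ∎

          -- At most s/q vertices are lost for each of at most `n` colours; the last summand `n` of
          -- `numeric` pays for them.
          discarded : q * # someHeavy? S ≤ n * s
          discarded = ≤-trans (#-any-bound heavy? q s U S (λ i → ≰⇒≥ (¬dense ∘ lose i))) (*-monoˡ-≤ s U≤n)

          room : n * (p * s + (p * s + (n * (p * s) + n * (n * (p * s))))) < q * length R
          room = +-cancelʳ-< (n * s) _ _ (begin-strict
            n * (p * s + (p * s + (n * (p * s) + n * (n * (p * s))))) + n * s
              ≡⟨ factor n p s ⟩
            (n * (p + (p + (n * p + n * (n * p)))) + n) * s
              <⟨ *-monoˡ-< s {{>-nonZero s>0}} numeric ⟩
            q * s
              ≡⟨ cong (q *_) (#-complement someHeavy? S) ⟨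
            q * (# (λ v → ¬? (someHeavy? v)) S + # someHeavy? S)
              ≡⟨ *-distribˡ-+ q _ (# someHeavy? S) ⟩
            q * # (λ v → ¬? (someHeavy? v)) S + q * # someHeavy? S
              ≤⟨ +-mono-≤ (≤-reflexive (cong (q *_) (sym (length-filter≡# (λ v → ¬? (someHeavy? v)) S)))) discarded ⟩
            q * length R + n * s ∎)
            where
            factor : ∀ n p s → n * (p * s + (p * s + (n * (p * s) + n * (n * (p * s))))) + n * s
                             ≡ (n * (p + (p + (n * p + n * (n * p)))) + n) * s
            factor = solve-∀

      shrink : ∀ k {s s'} → cost * cost ^ k ≤ s → s ≤ cost * s' → cost ^ k ≤ s'
      shrink k h h' = *-cancelˡ-≤ cost (≤-trans h h')

      -- The budget `cost ^ k` pays for `k` steps. While a step remains, it also gives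
      -- `cost ≤ length S`, the size needed by `rainbow` and `dependentChoice`.
      build : ∀ k U S → Unique S → cost ^ k ≤ length S → RainbowClique n ⊎ Chain U S k
      build zero    U S S! large = inj₂ end
      build (suc k) U S S! large with n ≤? length U
      ... | yes h = inj₂ (full h)
      ... | no ¬h with any? (λ v → any? (λ w → ¬? (any? (c v w ≟_) U)
                        ×-dec length S ≤? q * # (Edge? (c v w) v) S) S) S
      ...   | yes someStar = map₂ (star v∈S a∉U (proj₁ ∘ unfilter) (proj₂ ∘ unfilter))
          (build k (c v w ∷ U) S' (filter⁺ (Edge? (c v w) v) S!) (shrink k large size))
        where
        v w : V
        v = proj₁ (find someStar)
        w = proj₁ (find (proj₂ (proj₂ (find someStar))))
        v∈S : v ∈ S
        v∈S = proj₁ (proj₂ (find someStar))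
        a∉U : c v w ∉ U
        a∉U = proj₁ (proj₂ (proj₂ (find (proj₂ (proj₂ (find someStar))))))
        S' : List V
        S' = filter (Edge? (c v w) v) S
        unfilter : ∀ {x} → x ∈ S' → x ∈ S × Edge (c v w) v x
        unfilter = ∈-filter⁻ (Edge? (c v w) v)
        open ≤-Reasoning
        size : length S ≤ cost * length S'
        size = begin
          length S                    ≤⟨ proj₂ (proj₂ (proj₂ (find (proj₂ (proj₂ (find someStar)))))) ⟩
          q * # (Edge? (c v w) v) S   ≡⟨ cong (q *_) (length-filter≡# (Edge? (c v w) v) S) ⟨
          q * length S'               ≤⟨ *-monoˡ-≤ _ q≤cost ⟩
          cost * length S'               ∎
      ...   | no ¬star with any? (λ a → length S ≤? q * # (DependentChoice.heavy? (Edge? a) S q) S) U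
      ...     | no ¬dense = inj₁ (rainbow U S S! cost≤s (≰⇒≥ ¬h) ¬star ¬dense)
        where
        cost≤s : cost ≤ length S
        cost≤s = ≤-trans (m≤m*n cost (cost ^ k) {{m^n≢0 cost k}}) large
      ...     | yes dense = map₂ (drc a∈U (proj₁ ∘ ∈-filter⁻ (λ v → all? (Edge? a v) T)) (rich U S S! a T nonempty (proj₂ (proj₂ choice))))
          (build k U S' (filter⁺ (λ v → all? (Edge? a v) T) S!) k-large)
        where
        a : ℕ
        a = proj₁ (find dense)
        a∈U : a ∈ U
        a∈U = proj₁ (proj₂ (find dense))
        open DependentChoice (Edge? a) S q using (neighbourhood; common?; dependentChoice)
        cost≤s : cost ≤ length S
        cost≤s = ≤-trans (m≤m*n cost (cost ^ k) {{m^n≢0 cost k}}) large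
        double : ∀ Q x → Q * x + Q * x ≡ 2 * Q * x
        double = solve-∀
        choice : ∃[ T ] length S ≤ 2 * Q * length (neighbourhood T) ×
          (∀ W → length W ≡ Δ → All (_∈ neighbourhood T) W → n < # (common? W) S)
        choice = dependentChoice n Δ (<-≤-trans (>-nonZero⁻¹ cost) cost≤s)
          (≤-trans (≤-reflexive (double Q (n ^ t))) cost≤s) (proj₂ (proj₂ (find dense)))
        T S' : List V
        T = proj₁ choice
        S' = neighbourhood T
        k-large : cost ^ k ≤ length S'
        k-large = shrink k large (≤-trans (proj₁ (proj₂ choice)) (*-monoˡ-≤ _ 2Q≤cost))
        nonempty : 0 < length S'
        nonempty = <-≤-trans (m^n>0 cost k) k-large

-- Initial segments of lists as maps on `Fin n`.

AllPairs-lookup : ∀ {R : A → A → Set} {xs} → AllPairs R xs → ∀ i j → i Fin.< j → R (lookup xs i) (lookup xs j)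
AllPairs-lookup (r ∷ _)  Fin.zero    (Fin.suc j) _  = All.lookup r (∈-lookup j)
AllPairs-lookup (_ ∷ rs) (Fin.suc i) (Fin.suc j) lt = AllPairs-lookup rs i j (≤-pred lt)

module _ {R : A → A → Set} {xs : List A} (rs : AllPairs R xs) {n : ℕ} (n≤ : n ≤ length xs) where

  member : Fin n → A
  member i = lookup xs (inject≤ i n≤)

  member-< : ∀ {i j} → i Fin.< j → R (member i) (member j)
  member-< {i} {j} lt = AllPairs-lookup rs _ _
    (subst (λ k → suc k ≤ toℕ (inject≤ j n≤)) (sym (toℕ-inject≤ i n≤))
      (subst (suc (toℕ i) ≤_) (sym (toℕ-inject≤ j n≤)) lt))

  -- Trichotomy of the indices; used for `Unique` lists and for both components of `Forward`.
  member-injective : ∀ {B : Set} (g : A → B) → (∀ {x y} → R x y → g x ≢ g y) →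
    ∀ {i j} → g (member i) ≡ g (member j) → i ≡ j
  member-injective g R⇒≢ {i} {j} e with Fin-<-cmp i j
  ... | tri< lt _ _ = contradiction e (R⇒≢ (member-< lt))
  ... | tri≈ _ i≡j _ = i≡j
  ... | tri> _ _ gt = contradiction (sym e) (R⇒≢ (member-< gt))

sumFin≡∑ : ∀ n (f : A → ℕ) (g : Fin n → A) → sumFin n (f ∘ g) ≡ ∑ (tabulate g) f
sumFin≡∑ zero    f g = refl
sumFin≡∑ (suc n) f g = cong (f (g Fin.zero) +_) (sumFin≡∑ n f (g ∘ Fin.suc))

-- Canonical copies of `H`.

module _ {n : ℕ} (H : Graph n) where

  Adj? : ∀ u v → Dec (Adj H u v)
  Adj? u v = adj H u v ≟ᵇ true

  Adj⇒≢ : ∀ {u v} → Adj H u v → u ≢ v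
  Adj⇒≢ {u} h refl with trans (sym h) (irrefl H u)
  ... | ()

  degree≡# : ∀ v → degree H v ≡ # (Adj? v) (allFin n)
  degree≡# v = trans (sumFin≡∑ n (λ w → if adj H v w then 1 else 0) id) (∑-cong (allFin n) (λ w → indicator (adj H v w)))
    where
    indicator : ∀ b → (if b then 1 else 0) ≡ ⟦ b ≟ᵇ true ⟧
    indicator true  = refl
    indicator false = refl

  -- The identity is a proper colouring with `n` colours. This turns `3 ≤ χ` into `3 ≤ n` for the
  -- numerical estimates.
  χ≤n : ∀ {χ} → IsChromaticNumber H χ → χ ≤ n
  χ≤n (_ , minimal) = ≮⇒≥ λ n<χ → minimal n n<χ (id , λ _ _ → Adj⇒≢)

  module Copies {N : ℕ} (col : EdgeColoring N) (Δ : ℕ) where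

    c : Fin N → Fin N → ℕ
    c = proj₁ col

    open Colouring Fin._≟_ c (proj₂ col)
    open Chains n Δ

    rainbowCopy : RainbowClique n → ∃[ φ ] CanonicalCopy H col φ
    rainbowCopy (xs , size , xs! , rb) = φ , φ-injective , inj₂ (inj₁ canonical)
      where
      n≤ : n ≤ length xs
      n≤ = ≤-reflexive (sym size)

      φ : Fin n → Fin N
      φ = member xs! n≤

      φ-injective : ∀ {u v} → φ u ≡ φ v → u ≡ v
      φ-injective = member-injective xs! n≤ id id

      φ∈ : ∀ u → φ u ∈ xs
      φ∈ u = ∈-lookup (inject≤ u n≤)

      canonical : Rainbow H col φ
      canonical u v u' v' h h' e with rb (φ∈ u) (φ∈ v) (φ∈ u') (φ∈ v')
        (Adj⇒≢ h ∘ φ-injective) (Adj⇒≢ h' ∘ φ-injective) e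
      ... | inj₁ (p , q) = inj₁ (φ-injective p , φ-injective q)
      ... | inj₂ (p , q) = inj₂ (φ-injective p , φ-injective q)

    -- The star centres, in chain order, span a lexicographic complete graph, so the ordering is the
    -- identity and each vertex gets the colour of its star.
    lexicographicCopy : ∀ {L} → n ≤ length L → AllPairs Forward L → ∃[ φ ] CanonicalCopy H col φ
    lexicographicCopy n≤ fs = proj₁ ∘ member fs n≤ , member-injective fs n≤ proj₁ (proj₁ ∘ proj₂) ,
      inj₂ (inj₂ (id , id , proj₂ ∘ member fs n≤ , member-injective fs n≤ proj₂ proj₁ ,
        λ u v _ lt → proj₂ (proj₂ (member-< fs n≤ lt))))

    -- Monochromatic embedding by colour classes.

    module Embedding (maxDegree : ∀ v → degree H v ≤ Δ) {χ : ℕ} (f : Fin n → Fin χ) (proper : ProperColoring H χ f)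
      (a : ℕ) where

      rank : Fin n → ℕ
      rank = toℕ ∘ f

      -- A partial embedding stored as a total map: the values of `φ` outside `D` are arbitrary.
      record Embeds (D : Fin n → Set) (S : List (Fin N)) (φ : Fin n → Fin N) : Set where
        field
          inside    : ∀ {u} → D u → φ u ∈ S
          injective : ∀ {u v} → D u → D v → φ u ≡ φ v → u ≡ v
          edges     : ∀ {u v} → D u → D v → Adj H u v → Edge a (φ u) (φ v)

      open Embeds

      restrict : ∀ {D D' S S' φ} → (∀ {u} → D' u → D u) → S ⊆ S' → Embeds D S φ → Embeds D' S' φ
      restrict D'⇒D S⊆S' E = record
        { inside    = S⊆S' ∘ inside E ∘ D'⇒D
        ; injective = λ p q → injective E (D'⇒D p) (D'⇒D q)
        ; edges     = λ p q → edges E (D'⇒D p) (D'⇒D q) }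

      -- `x` avoids all values of `φ`, the arbitrary ones included; these form a list of length `n`,
      -- which is what `Rich` allows for `Z`.
      extend : ∀ {D S φ x} w → Embeds D S φ → x ∈ S → x ∉ map φ (allFin n) →
        (∀ {u} → D u → Adj H w u → Edge a (φ u) x) →
        Embeds (λ u → u ≡ w ⊎ D u) S (updateAt φ w (const x))
      extend {D} {S} {φ} {x} w E x∈S fresh joined = record { inside = inside⁺ ; injective = injective⁺ ; edges = edges⁺ }
        where
        φ⁺ : Fin n → Fin N
        φ⁺ = updateAt φ w (const x)

        data At (u : Fin n) : Set where
          new : u ≡ w → φ⁺ u ≡ x → At u
          old : D u → φ⁺ u ≡ φ u → At u

        at : ∀ {u} → u ≡ w ⊎ D u → At u
        at {u} d with u Fin.≟ w
        at d        | yes refl = new refl (updateAt-updates w φ)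
        at (inj₁ e) | no u≢w   = contradiction e u≢w
        at (inj₂ d) | no u≢w   = old d (updateAt-minimal _ w φ u≢w)

        x≢ : ∀ u → φ u ≢ x
        x≢ u e = fresh (subst (_∈ map φ (allFin n)) e (∈-map⁺ φ (∈-allFin u)))

        inside⁺ : ∀ {u} → u ≡ w ⊎ D u → φ⁺ u ∈ S
        inside⁺ d with at d
        ... | new _ e = subst (_∈ S) (sym e) x∈S
        ... | old d e = subst (_∈ S) (sym e) (inside E d)

        injective⁺ : ∀ {u v} → u ≡ w ⊎ D u → v ≡ w ⊎ D v → φ⁺ u ≡ φ⁺ v → u ≡ v
        injective⁺ {u} {v} d d' h with at d | at d'
        ... | new p _ | new p' _  = trans p (sym p')
        ... | new _ e | old _ e'  = contradiction (trans (sym e') (trans (sym h) e)) (x≢ v)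
        ... | old _ e | new _ e'  = contradiction (trans (sym e) (trans h e')) (x≢ u)
        ... | old p e | old p' e' = injective E p p' (trans (sym e) (trans h e'))

        edges⁺ : ∀ {u v} → u ≡ w ⊎ D u → v ≡ w ⊎ D v → Adj H u v → Edge a (φ⁺ u) (φ⁺ v)
        edges⁺ {u} {v} d d' h with at d | at d'
        ... | new p _ | new p' _  = contradiction (trans p (sym p')) (Adj⇒≢ h)
        ... | new refl e | old p' e' rewrite e | e' = Edge-sym (joined p' h)
        ... | old p e | new refl e'  rewrite e | e' = joined p (trans (Graph.sym H w u) h)
        ... | old p e | old p' e' rewrite e | e' = edges E p p' h

      -- ws lies in one colour class, so the neighbours of w ∈ ws embedded so far have smaller rank and lie in S'.
      layer : ∀ {m S S' φ} → S' ⊆ S → Rich a S' S → Embeds (λ u → rank u < m) S' φ →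
        ∀ ws → All (λ w → rank w ≡ m) ws →
        ∃[ ψ ] (∀ {u} → rank u < m → ψ u ∈ S') × Embeds (λ u → u ∈ ws ⊎ rank u < m) S ψ
      layer {φ = φ} S'⊆S rich E [] _ =
        φ , inside E , restrict (λ { (inj₂ d) → d }) S'⊆S E
      layer {m} {S} {S'} S'⊆S rich E (w ∷ ws) (w≡m ∷ ws≡m) =
        ψ⁺ , low⁺ , restrict (λ { (inj₁ (here e)) → inj₁ e ; (inj₁ (there i)) → inj₂ (inj₁ i) ; (inj₂ d) → inj₂ (inj₂ d) })
          id (extend w E' (proj₁ (proj₂ choice)) (proj₁ (proj₂ (proj₂ choice))) joined)
        where
        previous : ∃[ ψ ] (∀ {u} → rank u < m → ψ u ∈ S') × Embeds (λ u → u ∈ ws ⊎ rank u < m) S ψ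
        previous = layer S'⊆S rich E ws ws≡m

        ψ : Fin n → Fin N
        ψ = proj₁ previous

        low : ∀ {u} → rank u < m → ψ u ∈ S'
        low = proj₁ (proj₂ previous)

        E' : Embeds (λ u → u ∈ ws ⊎ rank u < m) S ψ
        E' = proj₂ (proj₂ previous)

        lowNeighbour? : ∀ u → Dec (Adj H w u × rank u < m)
        lowNeighbour? u = Adj? w u ×-dec rank u <? m

        nbrs : List (Fin n)
        nbrs = filter lowNeighbour? (allFin n)

        few : length (map ψ nbrs) ≤ Δ
        few = begin
          length (map ψ nbrs)             ≡⟨ length-map ψ nbrs ⟩
          length nbrs                     ≡⟨ length-filter≡# lowNeighbour? (allFin n) ⟩
          # lowNeighbour? (allFin n)      ≤⟨ #-mono lowNeighbour? (Adj? w) proj₁ (allFin n) ⟩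
          # (Adj? w) (allFin n)           ≡⟨ degree≡# w ⟨
          degree H w                      ≤⟨ maxDegree w ⟩
          Δ                               ∎
          where open ≤-Reasoning

        choice : ∃[ x ] x ∈ S × x ∉ map ψ (allFin n) × All (λ y → Edge a y x) (map ψ nbrs)
        choice = rich (map ψ nbrs) (map ψ (allFin n)) few
          (map⁺ (All.tabulate (λ i → low (proj₂ (proj₂ (∈-filter⁻ lowNeighbour? {xs = allFin n} i))))))
          (≤-reflexive (trans (length-map ψ (allFin n)) (length-tabulate id)))

        joined : ∀ {u} → u ∈ ws ⊎ rank u < m → Adj H w u → Edge a (ψ u) (proj₁ choice)
        joined {u} (inj₁ i) h = contradiction
          (toℕ-injective (trans w≡m (sym (All.lookup ws≡m i)))) (proper w u h)
        joined {u} (inj₂ d) h =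
          All.lookup (proj₂ (proj₂ (proj₂ choice))) (∈-map⁺ ψ (∈-filter⁺ lowNeighbour? (∈-allFin u) (h , d)))

        ψ⁺ : Fin n → Fin N
        ψ⁺ = updateAt ψ w (const (proj₁ choice))

        -- `w` has rank `m`, so moving it leaves the lower ranks inside `S'`, where `rich` can be
        -- applied again.
        low⁺ : ∀ {u} → rank u < m → ψ⁺ u ∈ S'
        low⁺ {u} d = subst (_∈ S') (sym (updateAt-minimal u w ψ λ { refl → <-irrefl w≡m d })) (low d)

      embed : Fin N → ∀ {m S} → Tower a S m → ∃[ φ ] Embeds (λ u → rank u < m) S φ
      -- No rank is below 0, so a constant map embeds the empty domain; `x₀` is only a default
      -- value.
      embed x₀ base = const x₀ , record { inside = λ () ; injective = λ () ; edges = λ () }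
      embed x₀ {suc m} (step S'⊆S rich tower) =
        let ψ , _ , E = layer S'⊆S rich (proj₂ (embed x₀ tower)) level
                          (All.tabulate (proj₂ ∘ ∈-filter⁻ (λ u → rank u ≟ m) {xs = allFin n}))
        in ψ , restrict onLevel id E
        where
        level : List (Fin n)
        level = filter (λ u → rank u ≟ m) (allFin n)

        onLevel : ∀ {u} → rank u < suc m → u ∈ level ⊎ rank u < m
        onLevel {u} lt with m≤n⇒m<n∨m≡n (≤-pred lt)
        ... | inj₁ lt' = inj₂ lt'
        ... | inj₂ e   = inj₁ (∈-filter⁺ (λ u → rank u ≟ m) (∈-allFin u) e)

      monochromaticCopy : Fin N → ∀ {S} → Tower a S χ → ∃[ φ ] CanonicalCopy H col φ
      monochromaticCopy x₀ tower =
        let φ , E = embed x₀ tower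
            all<χ = λ u → toℕ<n (f u)
        in φ , injective E (all<χ _) (all<χ _) , inj₁ (a , λ u v h → proj₂ (edges E (all<χ u) (all<χ v) h))

    canonicalCopy : ∀ p (n>0 : 0 < n) (numeric : n * (p + (p + (n * p + n * (n * p)))) + n < p * p) →
      (∀ v → degree H v ≤ Δ) → ∀ {χ} → Colorable H χ →
      (2 * (p * p) ^ suc (suc Δ) * n ^ suc Δ) ^ (n * suc χ) ≤ N → ∃[ φ ] CanonicalCopy H col φ
    canonicalCopy p n>0 numeric maxDegree {χ} (f , proper) large
      with build (n * suc χ) [] (allFin N) (allFin⁺ N) (subst (_ ≤_) (sym (length-tabulate id)) large)
      where open Build p n>0 numeric
    ... | inj₁ clique = rainbowCopy clique
    ... | inj₂ chain with starsOrTower χ chain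
    ...   | inj₁ (L , n≤ , fs) = lexicographicCopy n≤ fs
    ...   | inj₂ (a , tower) = Embedding.monochromaticCopy maxDegree f proper a
      -- `N` is at least a positive power of `cost`, which supplies the default vertex.
      (Fin.fromℕ< (<-≤-trans (m^n>0 cost (n * suc χ)) large)) tower
      where open Build p n>0 numeric

-- Numerical estimates.

numeric-bound : ∀ n → 3 ≤ n → let p = n ^ 5 in n * (p + (p + (n * p + n * (n * p)))) + n < p * p
numeric-bound n 3≤n = begin-strict
  n * (p + (p + (n * p + n * (n * p)))) + n
    ≤⟨ +-mono-≤ (*-monoʳ-≤ n (+-mono-≤ p≤y (+-mono-≤ p≤y (+-monoˡ-≤ y np≤y)))) n≤ny ⟩
  n * (y + (y + (y + y))) + n * y
    ≡⟨ five n y ⟩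
  5 * (n * y)
    <⟨ *-monoˡ-< (n * y) {{m*n≢0 n y}} {5} {9} (s≤s (s≤s (s≤s (s≤s (s≤s (s≤s z≤n)))))) ⟩
  9 * (n * y)
    ≤⟨ *-monoˡ-≤ (n * y) (*-mono-≤ 3≤n 3≤n) ⟩
  n * n * (n * y)
    ≡⟨ power n ⟩
  p * p ∎
  where
  open ≤-Reasoning
  -- Expanded, the left side has five terms, each at most `n * y`, which is n^8; and 5 n^8 < 9 n^8 ≤
  -- n^10 since `3 ≤ n`.
  p y : ℕ
  p = n ^ 5
  y = n * (n * p)
  instance
    n≢0 : NonZero n
    n≢0 = >-nonZero (<-≤-trans (s≤s z≤n) 3≤n)
    p≢0 : NonZero p
    p≢0 = m^n≢0 n 5
    y≢0 : NonZero y
    y≢0 = m*n≢0 n (n * p) {{n≢0}} {{m*n≢0 n p}}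
  np≤y : n * p ≤ y
  np≤y = m≤n*m (n * p) n
  p≤y : p ≤ y
  p≤y = ≤-trans (m≤n*m p n) np≤y
  n≤ny : n ≤ n * y
  n≤ny = m≤m*n n y
  five : ∀ n y → n * (y + (y + (y + y))) + n * y ≡ 5 * (n * y)
  five = solve-∀
  power : ∀ n → n * n * (n * (n * (n * n ^ 5))) ≡ n ^ 5 * n ^ 5
  power n = trans (rearrange n (n ^ 5)) refl
    where
    rearrange : ∀ n p → n * n * (n * (n * (n * p))) ≡ n * (n * (n * (n * (n * 1)))) * p
    rearrange = solve-∀

-- With `2 ≤ n`, one step costs at most n to the power 1 + 10(Δ+2) + (Δ+1) = 11Δ + 22, which is at
-- most 22Δ as `2 ≤ Δ`. The n(χ+1) ≤ 2nχ steps double this to 44.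
exponent-bound : ∀ n Δ χ → 3 ≤ n → 2 ≤ Δ → 1 ≤ χ →
  (2 * (n ^ 5 * n ^ 5) ^ suc (suc Δ) * n ^ suc Δ) ^ (n * suc χ) ≤ n ^ (44 * Δ * χ * n)
exponent-bound n Δ χ 3≤n 2≤Δ 1≤χ = begin
  (2 * (n ^ 5 * n ^ 5) ^ suc (suc Δ) * n ^ suc Δ) ^ (n * suc χ)
    ≤⟨ ^-monoˡ-≤ (n * suc χ) base ⟩
  (n ^ (22 * Δ)) ^ (n * suc χ)
    ≡⟨ ^-*-assoc n (22 * Δ) (n * suc χ) ⟩
  n ^ (22 * Δ * (n * suc χ))
    ≤⟨ ^-monoʳ-≤ n (≤-trans (*-monoʳ-≤ (22 * Δ) (*-monoʳ-≤ n (+-monoˡ-≤ χ 1≤χ))) (≤-reflexive (expand Δ n χ))) ⟩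
  n ^ (44 * Δ * χ * n) ∎
  where
  open ≤-Reasoning
  instance
    n≢0 : NonZero n
    n≢0 = >-nonZero (<-≤-trans (s≤s z≤n) 3≤n)
  expand : ∀ Δ n χ → 22 * Δ * (n * (χ + χ)) ≡ 44 * Δ * χ * n
  expand = solve-∀
  total : ∀ Δ → 1 + 10 * suc (suc Δ) + suc Δ ≡ 11 * Δ + 11 * 2
  total = solve-∀
  double : ∀ Δ → 11 * Δ + 11 * Δ ≡ 22 * Δ
  double = solve-∀
  base : 2 * (n ^ 5 * n ^ 5) ^ suc (suc Δ) * n ^ suc Δ ≤ n ^ (22 * Δ)
  base = begin
    2 * (n ^ 5 * n ^ 5) ^ suc (suc Δ) * n ^ suc Δ
      ≡⟨ cong (λ q → 2 * q ^ suc (suc Δ) * n ^ suc Δ) (^-distribˡ-+-* n 5 5) ⟨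
    2 * (n ^ 10) ^ suc (suc Δ) * n ^ suc Δ
      ≡⟨ cong (λ q → 2 * q * n ^ suc Δ) (^-*-assoc n 10 (suc (suc Δ))) ⟩
    2 * n ^ (10 * suc (suc Δ)) * n ^ suc Δ
      ≤⟨ *-monoˡ-≤ (n ^ suc Δ) (*-monoˡ-≤ (n ^ (10 * suc (suc Δ))) (≤-trans (n≤1+n 2) 3≤n)) ⟩
    n ^ (1 + 10 * suc (suc Δ)) * n ^ suc Δ
      ≡⟨ ^-distribˡ-+-* n (1 + 10 * suc (suc Δ)) (suc Δ) ⟨
    n ^ (1 + 10 * suc (suc Δ) + suc Δ)
      ≤⟨ ^-monoʳ-≤ n (≤-trans (≤-reflexive (total Δ)) (≤-trans (+-monoʳ-≤ (11 * Δ) (*-monoʳ-≤ 11 2≤Δ)) (≤-reflexive (double Δ)))) ⟩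
    n ^ (22 * Δ) ∎

theorem2p4 : ∃[ C ] (∀ (n : ℕ) (H : Graph n) (Δ χ : ℕ) →
    IsMaxDegree H Δ → 2 ≤ Δ →
    IsChromaticNumber H χ → 3 ≤ χ →
    ER≤ H (n ^ (C * Δ * χ * n)))
theorem2p4 = 44 , λ n H Δ χ maxDegree 2≤Δ chromatic 3≤χ →
  let 3≤n = ≤-trans 3≤χ (χ≤n H chromatic) in
  n ^ (44 * Δ * χ * n) , ≤-refl , λ col →
    Copies.canonicalCopy H col Δ (n ^ 5) (<-≤-trans (s≤s z≤n) 3≤n) (numeric-bound n 3≤n) (proj₁ maxDegree)
      (proj₁ chromatic) (exponent-bound n Δ χ 3≤n 2≤Δ (≤-trans (s≤s z≤n) 3≤χ))
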